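{- Let $G=(V,E)$ be a finite simple connected graph. Then $\beth^{1}(K^{h(G)})\le \beth^{1}(G)$; that is, $$\binom{h(G)}{2}-\binom{h(G)}{1}\le |E|-|V|.$$
   Context: All graphs are finite and simple. $K^{t}$ is the complete graph on $t$ vertices. The Hadwiger number $h(G)$ is the maximum $t$ such that $K^{t}$ is a minor of $G$. For a connected graph $G$, the first graph characteristic is $\beth^{1}(G)=|E(G)|-|V(G)|$. -}

module Defs where

open import Data.Fin using (Fin)
open import Data.Fin.Properties using (_<?_; _≟_)
open import Data.Fin.Subset using (Subset; _∈_; _∩_; ⊤; Nonempty; Empty)
open import Data.Integer using (ℤ; +_; _-_)
open import Data.List using (List; allFin; cartesianProduct; filter; length)
open import Data.Nat using (ℕ; _≤_)
open import Data.Product using (_×_; _,_; ∃₂)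
open import Level using (0ℓ)
open import Relation.Binary.Construct.Closure.ReflexiveTransitive using (Star)
open import Relation.Binary.Core using (Rel)
open import Relation.Binary.Definitions using (Decidable; Irreflexive; Symmetric)
open import Relation.Binary.PropositionalEquality using (_≡_; _≢_; ≢-sym)
open import Relation.Nullary.Decidable using (¬?; _×-dec_)

record Graph : Set₁ where
  field
    order      : ℕ
    Adj        : Rel (Fin order) 0ℓ
    adj?       : Decidable Adj
    adj-sym    : Symmetric Adj
    adj-irrefl : Irreflexive _≡_ Adj

  Vertex : Set
  Vertex = Fin order

  -- Each edge is listed once, by its endpoints in increasing order.
  edges : List (Vertex × Vertex)
  edges = filter (λ (u , v) → (u <? v) ×-dec adj? u v)
                 (cartesianProduct (allFin order) (allFin order))

open Graph public using (Vertex)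

∣V∣ : Graph → ℕ
∣V∣ = Graph.order

∣E∣ : Graph → ℕ
∣E∣ G = length (Graph.edges G)

K : ℕ → Graph
K t = record
  { order      = t
  ; Adj        = _≢_
  ; adj?       = λ u v → ¬? (u ≟ v)
  ; adj-sym    = ≢-sym
  ; adj-irrefl = λ u≡v u≢v → u≢v u≡v
  }

module _ (G : Graph) where
  open Graph G using (order; Adj)

  AdjWithin : Subset order → Rel (Vertex G) 0ℓ
  AdjWithin S u v = u ∈ S × v ∈ S × Adj u v

  -- The subgraph induced on S is connected; in particular S is nonempty.
  ConnectedOn : Subset order → Set
  ConnectedOn S = Nonempty S × (∀ {u v} → u ∈ S → v ∈ S → Star (AdjWithin S) u v)

  Connected : Set
  Connected = ConnectedOn ⊤

-- H ≼ G: H is obtained from a subgraph of G by contracting each (connected)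
-- branch set to a single vertex; vertices of G in no branch set are deleted.
record _≼_ (H G : Graph) : Set where
  field
    branch    : Vertex H → Subset (Graph.order G)
    connected : ∀ x → ConnectedOn G (branch x)
    disjoint  : ∀ {x y} → x ≢ y → Empty (branch x ∩ branch y)
    adjacent  : ∀ {x y} → Graph.Adj H x y →
                ∃₂ λ u v → u ∈ branch x × v ∈ branch y × Graph.Adj G u v

IsHadwigerNumber : Graph → ℕ → Set
IsHadwigerNumber G h = K h ≼ G × (∀ t → K t ≼ G → t ≤ h)

ℶ¹ : Graph → ℤ
ℶ¹ G = + ∣E∣ G - + ∣V∣ G

{-# OPTIONS --safe #-}
-- Choose a root in every branch set of a minor H of G. Inside its branch set, or
-- outside all branch sets on the way to one of them, every non-root has a
-- neighbour strictly closer to the roots. The edges from the non-roots to these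
-- neighbours are pairwise distinct and never join two different branch sets, so
-- together with one edge of G for every edge of H they give
-- |E(H)| + (|V(G)| - |V(H)|) ≤ |E(G)|: ℶ¹ is monotone under nonempty minors.
module Submission where

open import Defs
open import Data.Nat.Combinatorics using (_C_; nC1≡n; nCk+nC[k+1]≡[n+1]C[k+1])
open import Data.Integer using (+_; -_; _-_; _≤_; +≤+; _⊖_)
open import Data.Empty using (⊥; ⊥-elim)
open import Data.Fin as Fin using (Fin; zero; suc)
import Data.Fin.Properties as Fin
open import Data.Fin.Subset as Subset using (⊤)
open import Data.Fin.Subset.Properties using (∈⊤; x∈p∩q⁺) renaming (_∈?_ to _∈ˢ?_)
import Data.Integer.Properties as ℤ
open import Data.List using (List; []; _∷_; _++_; allFin; cartesianProduct; filter; length; lookup; map)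
open import Data.List.Membership.Propositional using (_∈_)
open import Data.List.Membership.Propositional.Properties
open import Data.List.Membership.Setoid.Properties using (index-injective)
open import Data.List.Properties using (length-++; length-map; length-tabulate)
import Data.List.Relation.Unary.All as All
open import Data.List.Relation.Unary.AllPairs using ([]; _∷_)
open import Data.List.Relation.Unary.Any using (index)
open import Data.List.Relation.Unary.Unique.Propositional using (Unique)
import Data.List.Relation.Unary.Unique.Propositional.Properties as Unique
open import Data.Nat as ℕ using (ℕ; zero; suc; z≤n; s≤s)
import Data.Nat.Properties as ℕ
open import Data.Product using (_×_; _,_; ∃; proj₁; proj₂)
open import Data.Sum using (_⊎_; inj₁; inj₂)
open import Data.Sum.Properties using (inj₁-injective; inj₂-injective)
open import Function using (id; _∘_)
open import Level using (Level; 0ℓ)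
open import Relation.Binary.Construct.Closure.ReflexiveTransitive as Star using (Star; ε; _◅_)
open import Relation.Binary.Core using (Rel; REL)
import Relation.Binary.Definitions as Binary
open import Relation.Binary.Definitions using (tri<; tri≈; tri>)
open import Relation.Binary.PropositionalEquality
open import Relation.Nullary using (¬_; yes; no)
open import Relation.Nullary.Decidable using (¬?; _×-dec_; _⊎-dec_; _→-dec_; decidable-stable)
open import Relation.Unary using (Pred; Decidable)

private
  variable
    a b ℓ : Level
    A : Set a
    B : Set b

-- Counting in duplicate-free lists.

lookup-injective : {xs : List A} → Unique xs → ∀ i j → lookup xs i ≡ lookup xs j → i ≡ j
lookup-injective (x∉xs ∷ _) zero    zero    _  = refl
lookup-injective (x∉xs ∷ _) zero    (suc j) eq = ⊥-elim (All.lookup x∉xs (∈-lookup j) eq)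
lookup-injective (x∉xs ∷ _) (suc i) zero    eq = ⊥-elim (All.lookup x∉xs (∈-lookup i) (sym eq))
lookup-injective (_ ∷ xs!)  (suc i) (suc j) eq = cong suc (lookup-injective xs! i j eq)

-- Choosing the position of an image in `ys` for every position in `xs` gives an injection between
-- finite types. A relation stands in for the map, so an image may be produced from the proof of
-- membership.
length-≤-by-injection : {_∼_ : REL A B ℓ} {xs : List A} {ys : List B} →
  (∀ {x x′ y} → x ∼ y → x′ ∼ y → x ≡ x′) → Unique xs →
  (∀ {x} → x ∈ xs → ∃ λ y → y ∈ ys × x ∼ y) → length xs ℕ.≤ length ys
length-≤-by-injection {_∼_ = _∼_} {xs} {ys} ∼-inj xs! image = Fin.injective⇒≤ target-injective
  where
  target : Fin (length xs) → Fin (length ys)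
  target i = index (proj₁ (proj₂ (image (∈-lookup i))))

  target-injective : ∀ {i j} → target i ≡ target j → i ≡ j
  target-injective {i} {j} eq with image (∈-lookup i) | image (∈-lookup j)
  ... | _ , y∈ , x∼y | _ , y′∈ , x′∼y′ = lookup-injective xs! i j
    (∼-inj x∼y (subst (_ ∼_) (sym (index-injective (setoid _) y∈ y′∈ eq)) x′∼y′))

length-≤-by-⊆ : {xs ys : List A} → Unique xs → (∀ {x} → x ∈ xs → x ∈ ys) →
  length xs ℕ.≤ length ys
length-≤-by-⊆ xs! xs⊆ys =
  length-≤-by-injection {_∼_ = _≡_} (λ p q → trans p (sym q)) xs! (λ x∈ → _ , xs⊆ys x∈ , refl)

-- Distance to a set of roots in a finite digraph.

least : {P : Pred ℕ ℓ} → Decidable P → ∀ n → P n → ∃ λ m → P m × (∀ {k} → P k → m ℕ.≤ k)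
least P? zero    p₀ = 0 , p₀ , λ _ → z≤n
least P? (suc n) pₙ with P? 0
... | yes p₀ = 0 , p₀ , λ _ → z≤n
... | no ¬p₀ with least (P? ∘ suc) n pₙ
... | m , pₘ , m≤ = suc m , pₘ , λ { {zero} p₀ → ⊥-elim (¬p₀ p₀) ; {suc k} pₖ → s≤s (m≤ pₖ) }

module _ {n : ℕ} {Root : Pred (Fin n) ℓ} {_⟶_ : Rel (Fin n) ℓ}
         (root? : Decidable Root) (_⟶?_ : Binary.Decidable _⟶_) where

  -- Recursion on the number of steps, instead of a quantifier over paths, makes this decidable by
  -- finite search, so the least number of steps can be found.
  RootWithin : ℕ → Pred (Fin n) ℓ
  RootWithin zero    v = Root v
  RootWithin (suc k) v = RootWithin k v ⊎ ∃ λ w → v ⟶ w × RootWithin k w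

  rootWithin? : ∀ k → Decidable (RootWithin k)
  rootWithin? zero    v = root? v
  rootWithin? (suc k) v = rootWithin? k v ⊎-dec Fin.any? λ w → (v ⟶? w) ×-dec rootWithin? k w

  path⇒rootWithin : ∀ {v r} → Root r → Star _⟶_ v r → ∃ λ k → RootWithin k v
  path⇒rootWithin root ε = 0 , root
  path⇒rootWithin root (v⟶w ◅ path) with path⇒rootWithin root path
  ... | k , within = suc k , inj₂ (_ , v⟶w , within)

  -- `depth` is the distance to the nearest root; the first step of a shortest path to a root
  -- decreases it.
  descent-to-roots : (∀ v → ∃ λ r → Root r × Star _⟶_ v r) →
    ∃ λ (depth : Fin n → ℕ) → ∀ v → ¬ Root v → ∃ λ w → v ⟶ w × depth w ℕ.< depth v
  descent-to-roots reach = proj₁ ∘ nearest , descend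
    where
    nearest : ∀ v → ∃ λ m → RootWithin m v × (∀ {k} → RootWithin k v → m ℕ.≤ k)
    nearest v with reach v
    ... | _ , root , path with path⇒rootWithin root path
    ... | k , within = least (λ k → rootWithin? k v) k within

    descend : ∀ v → ¬ Root v → ∃ λ w → v ⟶ w × proj₁ (nearest w) ℕ.< proj₁ (nearest v)
    descend v ¬root with nearest v
    ... | zero  , root        , _  = ⊥-elim (¬root root)
    -- Here a root would already be within `k` steps, against the minimality of `suc k`.
    ... | suc k , inj₁ within , m≤ = ⊥-elim (ℕ.1+n≰n (m≤ within))
    ... | suc k , inj₂ (w , v⟶w , within) , _ = w , v⟶w , s≤s (proj₂ (proj₂ (nearest w)) within)

-- The edge list of a graph.

module _ (G : Graph) where
  open Graph G using (order; Adj; adj?; edges)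

  private
    edge? : Decidable {A = Vertex G × Vertex G} λ (u , v) → u Fin.< v × Adj u v
    edge? (u , v) = (u Fin.<? v) ×-dec adj? u v

  ∈-edges⁺ : ∀ {u v} → u Fin.< v → Adj u v → (u , v) ∈ edges
  ∈-edges⁺ {u} {v} u<v uv =
    ∈-filter⁺ edge? (∈-cartesianProduct⁺ (∈-allFin u) (∈-allFin v)) (u<v , uv)

  ∈-edges⁻ : ∀ {u v} → (u , v) ∈ edges → u Fin.< v × Adj u v
  ∈-edges⁻ = proj₂ ∘ ∈-filter⁻ edge? {xs = cartesianProduct (allFin order) (allFin order)}

  edges-unique : Unique edges
  edges-unique =
    Unique.filter⁺ edge? (Unique.cartesianProduct⁺ (Unique.allFin⁺ order) (Unique.allFin⁺ order))

-- Monotonicity of `ℶ¹` under minors.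

module _ {G H : Graph} (G-connected : Connected G) (x₀ : Vertex H) (H≼G : H ≼ G) where
  open Graph G using (Adj; adj?; adj-sym; adj-irrefl)
  open _≼_ H≼G

  branch-unique : ∀ {v x y} → v Subset.∈ branch x → v Subset.∈ branch y → x ≡ y
  branch-unique v∈x v∈y =
    decidable-stable (_ Fin.≟ _) λ x≢y → disjoint x≢y (_ , x∈p∩q⁺ (v∈x , v∈y))

  root : Vertex H → Vertex G
  root x = proj₁ (proj₁ (connected x))

  root∈branch : ∀ x → root x Subset.∈ branch x
  root∈branch x = proj₂ (proj₁ (connected x))

  IsRoot : Pred (Vertex G) 0ℓ
  IsRoot v = ∃ λ x → v ≡ root x

  isRoot? : Decidable IsRoot
  isRoot? v = Fin.any? λ x → v Fin.≟ root x

  -- A step may enter a branch set from outside but never leaves one; the condition is vacuous when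
  -- `u` lies in no branch set.
  _⟶_ : Rel (Vertex G) 0ℓ
  u ⟶ v = Adj u v × (∀ x → u Subset.∈ branch x → v Subset.∈ branch x)

  _⟶?_ : Binary.Decidable _⟶_
  u ⟶? v = adj? u v ×-dec Fin.all? λ x → (u ∈ˢ? branch x) →-dec (v ∈ˢ? branch x)

  within-branch⇒⟶ : ∀ {x u v} → AdjWithin G (branch x) u v → u ⟶ v
  within-branch⇒⟶ (u∈x , v∈x , uv) =
    uv , λ y u∈y → subst (λ z → _ Subset.∈ branch z) (branch-unique u∈x u∈y) v∈x

  -- Follow a path of `G` towards `root x₀` until it first meets a branch set; that set is
  -- connected, so the path can be completed to its root inside it.
  root-reachable : ∀ v → ∃ λ r → IsRoot r × Star _⟶_ v r
  root-reachable v = along (proj₂ G-connected {v} {root x₀} ∈⊤ ∈⊤)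
    where
    along : ∀ {v} → Star (AdjWithin G ⊤) v (root x₀) → ∃ λ r → IsRoot r × Star _⟶_ v r
    along {v} path with Fin.any? (λ x → v ∈ˢ? branch x)
    ... | yes (x , v∈x) =
      root x , (x , refl) , Star.map within-branch⇒⟶ (proj₂ (connected x) v∈x (root∈branch x))
    along ε | no _ = _ , (x₀ , refl) , ε
    along ((_ , _ , vw) ◅ path) | no v∉branches with along path
    ... | r , r-root , w⟶*r = r , r-root , (vw , λ x v∈x → ⊥-elim (v∉branches (x , v∈x))) ◅ w⟶*r

  private
    descent = descent-to-roots isRoot? _⟶?_ root-reachable

  depth : Vertex G → ℕ
  depth = proj₁ descent

  -- The oriented edges of G charged to an edge of H or to a non-root of G.
  data Charged : (Vertex H × Vertex H) ⊎ Vertex G → Rel (Vertex G) 0ℓ where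
    cross  : ∀ {x y u v} → x Fin.< y → u Subset.∈ branch x → v Subset.∈ branch y →
             Charged (inj₁ (x , y)) u v
    parent : ∀ {u v} → u ⟶ v → depth v ℕ.< depth u → Charged (inj₂ u) u v

  -- Disjointness of the branch sets recovers `x` and `y` from the endpoints of a `cross` edge, and
  -- a `parent` edge is indexed by its tail. The two kinds exclude each other, since `_⟶_` cannot
  -- pass from one branch set to another.
  charged-unique : ∀ {p q u v} → Charged p u v → Charged q u v → p ≡ q
  charged-unique (cross _ u∈x v∈y) (cross _ u∈x′ v∈y′) =
    cong inj₁ (cong₂ _,_ (branch-unique u∈x u∈x′) (branch-unique v∈y v∈y′))
  charged-unique (cross x<y u∈x v∈y) (parent (_ , stays) _) =
    ⊥-elim (Fin.<⇒≢ x<y (branch-unique (stays _ u∈x) v∈y))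
  charged-unique (parent (_ , stays) _) (cross x<y u∈x v∈y) =
    ⊥-elim (Fin.<⇒≢ x<y (branch-unique (stays _ u∈x) v∈y))
  charged-unique (parent _ _) (parent _ _) = refl

  -- Rules out that the two orientations of one edge are both charged: two `cross` edges would
  -- reverse the order of `x` and `y`, two `parent` edges would each decrease `depth`, and a mixed
  -- pair would make `_⟶_` leave a branch set.
  charged-asym : ∀ {p q u v} → Charged p u v → Charged q v u → ⊥
  charged-asym (cross x<y u∈x v∈y) (cross x′<y′ v∈x′ u∈y′)
    with refl ← branch-unique u∈x u∈y′ | refl ← branch-unique v∈y v∈x′ = Fin.<-asym x<y x′<y′
  charged-asym (cross x<y u∈x v∈y) (parent (_ , stays) _) =
    Fin.<⇒≢ x<y (branch-unique u∈x (stays _ v∈y))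
  charged-asym (parent (_ , stays) _) (cross x<y v∈x u∈y) =
    Fin.<⇒≢ x<y (branch-unique v∈x (stays _ u∈y))
  charged-asym (parent _ v<u) (parent _ u<v) = ℕ.<-asym v<u u<v

  ChargedTo : REL ((Vertex H × Vertex H) ⊎ Vertex G) (Vertex G × Vertex G) 0ℓ
  ChargedTo p (u , v) = Charged p u v ⊎ Charged p v u

  chargedTo-injective : ∀ {p q e} → ChargedTo p e → ChargedTo q e → p ≡ q
  chargedTo-injective (inj₁ c) (inj₁ d) = charged-unique c d
  chargedTo-injective (inj₁ c) (inj₂ d) = ⊥-elim (charged-asym c d)
  chargedTo-injective (inj₂ c) (inj₁ d) = ⊥-elim (charged-asym c d)
  chargedTo-injective (inj₂ c) (inj₂ d) = charged-unique c d

  charged-edge : ∀ {p u v} → Adj u v → Charged p u v → ∃ λ e → e ∈ Graph.edges G × ChargedTo p e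
  charged-edge {u = u} {v} uv c with Fin.<-cmp u v
  ... | tri< u<v _ _ = _ , ∈-edges⁺ G u<v uv , inj₁ c
  ... | tri≈ _ u≡v _ = ⊥-elim (adj-irrefl u≡v uv)
  ... | tri> _ _ v<u = _ , ∈-edges⁺ G v<u (adj-sym uv) , inj₂ c

  private
    nonRoot? : Decidable (¬_ ∘ IsRoot)
    nonRoot? v = ¬? (isRoot? v)

  nonRoots : List (Vertex G)
  nonRoots = filter nonRoot? (allFin (∣V∣ G))

  -- Every vertex is a non-root or the root of some branch set. An upper bound on `∣V∣ G` is the
  -- direction that bounds `ℶ¹ G` from below.
  ∣V∣≤∣V∣+∣nonRoots∣ : ∣V∣ G ℕ.≤ ∣V∣ H ℕ.+ length nonRoots
  ∣V∣≤∣V∣+∣nonRoots∣ = begin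
    ∣V∣ G                                  ≡⟨ length-tabulate id ⟨
    length (allFin (∣V∣ G))                ≤⟨ length-≤-by-⊆ (Unique.allFin⁺ _) (λ {v} _ → cover v) ⟩
    length (map root vertices ++ nonRoots) ≡⟨ length-++ (map root vertices) ⟩
    length (map root vertices) ℕ.+ length nonRoots
      ≡⟨ cong (ℕ._+ length nonRoots) (trans (length-map root vertices) (length-tabulate id)) ⟩
    ∣V∣ H ℕ.+ length nonRoots              ∎
    where
    open ℕ.≤-Reasoning

    vertices : List (Vertex H)
    vertices = allFin (∣V∣ H)

    cover : ∀ v → v ∈ map root vertices ++ nonRoots
    cover v with isRoot? v
    ... | yes (x , refl) = ∈-++⁺ˡ (∈-map⁺ root (∈-allFin x))
    ... | no ¬root       = ∈-++⁺ʳ (map root vertices) (∈-filter⁺ nonRoot? (∈-allFin v) ¬root)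

  -- Each edge of `H` is charged to an edge of `G` between its branch sets, each non-root to an edge
  -- towards smaller `depth`; the charging is injective.
  ∣E∣+∣nonRoots∣≤∣E∣ : ∣E∣ H ℕ.+ length nonRoots ℕ.≤ ∣E∣ G
  ∣E∣+∣nonRoots∣≤∣E∣ = begin
    ∣E∣ H ℕ.+ length nonRoots
      ≡⟨ cong₂ ℕ._+_ (length-map inj₁ (Graph.edges H)) (length-map inj₂ nonRoots) ⟨
    length crossings ℕ.+ length parents ≡⟨ length-++ crossings ⟨
    length (crossings ++ parents)
      ≤⟨ length-≤-by-injection chargedTo-injective unique charge ⟩
    ∣E∣ G ∎
    where
    open ℕ.≤-Reasoning

    crossings parents : List ((Vertex H × Vertex H) ⊎ Vertex G)
    crossings = map inj₁ (Graph.edges H)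
    parents   = map inj₂ nonRoots

    unique : Unique (crossings ++ parents)
    unique = Unique.++⁺
      (Unique.map⁺ inj₁-injective (edges-unique H))
      (Unique.map⁺ inj₂-injective (Unique.filter⁺ nonRoot? (Unique.allFin⁺ _)))
      λ (p∈crossings , p∈parents) → apart (∈-map⁻ inj₁ p∈crossings) (∈-map⁻ inj₂ p∈parents)
      where
      apart : ∀ {p} → (∃ λ e → e ∈ Graph.edges H × p ≡ inj₁ e) →
              (∃ λ v → v ∈ nonRoots × p ≡ inj₂ v) → ⊥
      apart (_ , _ , refl) (_ , _ , ())

    charge : ∀ {p} → p ∈ crossings ++ parents → ∃ λ e → e ∈ Graph.edges G × ChargedTo p e
    charge p∈ with ∈-++⁻ crossings p∈
    charge p∈ | inj₁ p∈crossings with ∈-map⁻ inj₁ p∈crossings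
    ... | _ , xy∈ , refl with ∈-edges⁻ H xy∈
    ... | x<y , xy with adjacent xy
    ... | _ , _ , u∈x , v∈y , uv = charged-edge uv (cross x<y u∈x v∈y)
    charge p∈ | inj₂ p∈parents with ∈-map⁻ inj₂ p∈parents
    ... | v , v∈ , refl with proj₂ descent v (proj₂ (∈-filter⁻ nonRoot? {xs = allFin (∣V∣ G)} v∈))
    ... | _ , v⟶w , w<v = charged-edge (proj₁ v⟶w) (parent v⟶w w<v)

  ℶ¹-mono-≼ : ℶ¹ H ≤ ℶ¹ G
  ℶ¹-mono-≼ = begin
    + ∣E∣ H - + ∣V∣ H             ≡⟨ ℤ.m-n≡m⊖n (∣E∣ H) (∣V∣ H) ⟩
    -- Adding `r` to both terms brings them into the form of the two counts above.
    ∣E∣ H ⊖ ∣V∣ H                 ≡⟨ ℤ.+-cancelˡ-⊖ r (∣E∣ H) (∣V∣ H) ⟨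
    (r ℕ.+ ∣E∣ H) ⊖ (r ℕ.+ ∣V∣ H) ≡⟨ cong₂ _⊖_ (ℕ.+-comm r (∣E∣ H)) (ℕ.+-comm r (∣V∣ H)) ⟩
    (∣E∣ H ℕ.+ r) ⊖ (∣V∣ H ℕ.+ r) ≤⟨ ℤ.⊖-monoˡ-≤ (∣V∣ H ℕ.+ r) ∣E∣+∣nonRoots∣≤∣E∣ ⟩
    ∣E∣ G ⊖ (∣V∣ H ℕ.+ r)         ≤⟨ ℤ.⊖-monoʳ-≥-≤ (∣E∣ G) ∣V∣≤∣V∣+∣nonRoots∣ ⟩
    ∣E∣ G ⊖ ∣V∣ G                 ≡⟨ ℤ.m-n≡m⊖n (∣E∣ G) (∣V∣ G) ⟨
    + ∣E∣ G - + ∣V∣ G             ∎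
    where
    open ℤ.≤-Reasoning
    r = length nonRoots

-- Edges of complete graphs.

-- The recursion splits off the pairs starting at `zero`, mirroring Pascal's rule, so the length is
-- computed by induction; the filtered list `edges` offers no such recursion directly.
increasingPairs : ∀ n → List (Fin n × Fin n)
increasingPairs zero    = []
increasingPairs (suc n) =
  map (λ j → zero , suc j) (allFin n) ++ map (λ (i , j) → suc i , suc j) (increasingPairs n)

length-increasingPairs : ∀ n → length (increasingPairs n) ≡ n C 2
length-increasingPairs zero    = refl
length-increasingPairs (suc n) = begin
  length (increasingPairs (suc n))
    ≡⟨ length-++ (map _ (allFin n)) ⟩
  length (map _ (allFin n)) ℕ.+ length (map _ (increasingPairs n))
    ≡⟨ cong₂ ℕ._+_ (trans (length-map _ (allFin n)) (length-tabulate id))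
                   (trans (length-map _ (increasingPairs n)) (length-increasingPairs n)) ⟩
  n ℕ.+ n C 2     ≡⟨ cong (ℕ._+ n C 2) (nC1≡n n) ⟨
  n C 1 ℕ.+ n C 2 ≡⟨ nCk+nC[k+1]≡[n+1]C[k+1] n 1 ⟩
  suc n C 2       ∎
  where
  open ≡-Reasoning

increasingPairs-increasing : ∀ n {i j} → (i , j) ∈ increasingPairs n → i Fin.< j
increasingPairs-increasing (suc n) ij∈ with ∈-++⁻ (map _ (allFin n)) ij∈
... | inj₁ ∈₀ with ∈-map⁻ _ ∈₀
...   | _ , _ , refl = s≤s z≤n
increasingPairs-increasing (suc n) ij∈ | inj₂ ∈₊ with ∈-map⁻ _ ∈₊
...   | _ , kl∈ , refl = s≤s (increasingPairs-increasing n kl∈)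

increasingPairs-unique : ∀ n → Unique (increasingPairs n)
increasingPairs-unique zero    = []
increasingPairs-unique (suc n) = Unique.++⁺
  (Unique.map⁺ (λ { refl → refl }) (Unique.allFin⁺ n))
  (Unique.map⁺ (λ { refl → refl }) (increasingPairs-unique n))
  λ (∈₀ , ∈₊) → apart (∈-map⁻ _ ∈₀) (∈-map⁻ _ ∈₊)
  where
  apart : ∀ {p} → (∃ λ j → j ∈ allFin n × p ≡ (zero , suc j)) →
          (∃ λ ((i , j) : Fin n × Fin n) → (i , j) ∈ increasingPairs n × p ≡ (suc i , suc j)) → ⊥
  apart (_ , _ , refl) (_ , _ , ())

nC2≤∣E[Kn]∣ : ∀ n → n C 2 ℕ.≤ ∣E∣ (K n)
nC2≤∣E[Kn]∣ n = subst (ℕ._≤ ∣E∣ (K n)) (length-increasingPairs n)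
  (length-≤-by-⊆ (increasingPairs-unique n) λ ij∈ →
    let i<j = increasingPairs-increasing n ij∈ in ∈-edges⁺ (K n) i<j (Fin.<⇒≢ i<j))

-- Application to the Hadwiger number.

-- The whole graph serves as the single branch set. This forces the Hadwiger number to be positive.
K₁≼connected : ∀ {G} → Connected G → K 1 ≼ G
K₁≼connected G-connected = record
  { branch    = λ _ → ⊤
  ; connected = λ _ → G-connected
  ; disjoint  = λ { {zero} {zero} 0≢0 → ⊥-elim (0≢0 refl) }
  ; adjacent  = λ { {zero} {zero} 0≢0 → ⊥-elim (0≢0 refl) }
  }

corollary2p1p1 : (G : Graph) → Connected G → (h : ℕ) → IsHadwigerNumber G h →
    (ℶ¹ (K h) ≤ ℶ¹ G) × (+ (h C 2) - + (h C 1) ≤ + ∣E∣ G - + ∣V∣ G)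
corollary2p1p1 G G-connected h (Kₕ≼G , maximal) = ℶ¹≤ , (begin
  + (h C 2) - + (h C 1) ≡⟨ cong (λ k → + (h C 2) - + k) (nC1≡n h) ⟩
  + (h C 2) - + h       ≤⟨ ℤ.+-monoˡ-≤ (- + h) (+≤+ (nC2≤∣E[Kn]∣ h)) ⟩
  ℶ¹ (K h)              ≤⟨ ℶ¹≤ ⟩
  ℶ¹ G                  ∎)
  where
  open ℤ.≤-Reasoning

  ℶ¹≤ : ℶ¹ (K h) ≤ ℶ¹ G
  -- Maximality applied to `K 1` gives `1 ≤ h`, hence a vertex of `K h` to serve as `x₀`.
  ℶ¹≤ = ℶ¹-mono-≼ G-connected (Fin.fromℕ< (maximal 1 (K₁≼connected G-connected))) Kₕ≼G
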